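{- For $u,v,n \in \mathbb{N}$, let $C_4(u,v,n)$ denote the number of partitions of $n$ into $u$ distinct parts congruent to $1$ modulo $4$ and $v$ distinct parts congruent to $3$ modulo $4$ (all parts distinct). Let $D_4(u,v,n)$ denote the number of partitions $\lambda_1 + \cdots + \lambda_s$ of $n$ (positive integer parts, $\lambda_1\ge\lambda_2\ge\cdots\ge\lambda_s$) such that $u$ equals the number of parts congruent to $0$ or $1$ modulo $4$ plus twice the number of parts congruent to $6$ modulo $8$, and $v$ equals the number of parts congruent to $0$ or $3$ modulo $4$ plus twice the number of parts congruent to $2$ modulo $8$, satisfying the following conditions: (1) for all $i$, $\lambda_i \neq 2$; (2) for all $1\le i<s$, $\lambda_i - \lambda_{i+1} \geq 5$; (3) for all $1\le i<s$: if $\lambda_i - \lambda_{i+1} = 5$ then $\lambda_i \equiv 1, 4 \pmod 8$; if $\lambda_i - \lambda_{i+1} = 6$ then $\lambda_i \equiv 1, 3, 5, 7 \pmod 8$; if $\lambda_i - \lambda_{i+1} = 7$ then $\lambda_i \equiv 0, 1, 3, 4, 6, 7 \pmod 8$; if $\lambda_i - \lambda_{i+1} = 8$ then $\lambda_i \equiv 0, 1, 3, 4, 5, 7 \pmod 8$. Then $C_4(u,v,n)=D_4(u,v,n)$ for all $u,v,n\in\mathbb{N}$. -}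

module Defs where

open import Data.Empty using (⊥)
open import Data.List using (List; []; _∷_; map; _++_; filter; length)
open import Data.List.Membership.Propositional using (_∈_)
open import Data.List.Membership.Propositional.Properties
  using (∈-map⁺; ∈-map⁻; ∈-++⁺ˡ; ∈-++⁺ʳ; ∈-++⁻; ∈-filter⁺; ∈-filter⁻)
open import Data.List.Properties using (∷-injectiveʳ)
open import Data.List.Relation.Unary.All using (All; []; _∷_; all?)
open import Data.List.Relation.Unary.AllPairs using ([]; _∷_)
open import Data.List.Relation.Unary.Any using (here; there)
open import Data.List.Relation.Unary.Linked using (Linked; linked?)
open import Data.List.Relation.Unary.Unique.Propositional using (Unique)
import Data.List.Relation.Unary.Unique.Propositional.Properties as Uniqueₚ
open import Data.Nat
open import Data.Nat.DivMod using (_%_)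
open import Data.Nat.ListAction using (sum)
open import Data.Nat.Properties
open import Data.Product using (_×_; _,_; ∃-syntax)
open import Data.Sum using (inj₁; inj₂)
open import Function using (_⇔_; mk⇔)
open import Relation.Binary using () renaming (Decidable to Decidable₂)
open import Relation.Binary.PropositionalEquality
open import Relation.Nullary using (contradiction)
open import Relation.Nullary.Decidable using (¬?; _×-dec_; _→-dec_)
open import Relation.Unary using (Decidable)

open import Data.List.Membership.DecPropositional _≟_ using (_∈?_)
open import Data.List.Relation.Unary.Unique.DecPropositional _≟_ using (unique?)

-- The compositions of suc k + n whose first part is at least suc k.
compositionsFrom : ℕ → ℕ → List (List ℕ)
compositionsFrom k zero    = (suc k ∷ []) ∷ []
compositionsFrom k (suc n) =
  map (suc k ∷_) (compositionsFrom 0 n) ++ compositionsFrom (suc k) n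

compositions : ℕ → List (List ℕ)
compositions zero    = [] ∷ []
compositions (suc n) = compositionsFrom 0 n

partitions : ℕ → List (List ℕ)
partitions n = filter (linked? _≥?_) (compositions n)

IsPartition : ℕ → List ℕ → Set
IsPartition n λs = Linked _≥_ λs × All (0 <_) λs × sum λs ≡ n

-- The number of parts whose residue modulo k is in rs.
#parts : (k : ℕ) .{{_ : NonZero k}} → List ℕ → List ℕ → ℕ
#parts k rs λs = length (filter (λ x → x % k ∈? rs) λs)

IsC₄ : ℕ → ℕ → List ℕ → Set
IsC₄ u v λs =
    Unique λs
  × All (λ x → x % 4 ∈ 1 ∷ 3 ∷ []) λs
  × u ≡ #parts 4 (1 ∷ []) λs
  × v ≡ #parts 4 (3 ∷ []) λs

isC₄? : ∀ u v → Decidable (IsC₄ u v)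
isC₄? u v λs =
        unique? λs
  ×-dec all? (λ x → x % 4 ∈? 1 ∷ 3 ∷ []) λs
  ×-dec u ≟ #parts 4 (1 ∷ []) λs
  ×-dec v ≟ #parts 4 (3 ∷ []) λs

C₄ : ℕ → ℕ → ℕ → ℕ
C₄ u v n = length (filter (isC₄? u v) (partitions n))

-- Conditions on consecutive parts x = λᵢ and y = λᵢ₊₁. The first component
-- forces y < x, so truncated subtraction is the true difference.
Gap : ℕ → ℕ → Set
Gap x y =
    x ∸ y ≥ 5
  × (x ∸ y ≡ 5 → x % 8 ∈ 1 ∷ 4 ∷ [])
  × (x ∸ y ≡ 6 → x % 8 ∈ 1 ∷ 3 ∷ 5 ∷ 7 ∷ [])
  × (x ∸ y ≡ 7 → x % 8 ∈ 0 ∷ 1 ∷ 3 ∷ 4 ∷ 6 ∷ 7 ∷ [])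
  × (x ∸ y ≡ 8 → x % 8 ∈ 0 ∷ 1 ∷ 3 ∷ 4 ∷ 5 ∷ 7 ∷ [])

gap? : Decidable₂ Gap
gap? x y =
        x ∸ y ≥? 5
  ×-dec (x ∸ y ≟ 5 →-dec x % 8 ∈? 1 ∷ 4 ∷ [])
  ×-dec (x ∸ y ≟ 6 →-dec x % 8 ∈? 1 ∷ 3 ∷ 5 ∷ 7 ∷ [])
  ×-dec (x ∸ y ≟ 7 →-dec x % 8 ∈? 0 ∷ 1 ∷ 3 ∷ 4 ∷ 6 ∷ 7 ∷ [])
  ×-dec (x ∸ y ≟ 8 →-dec x % 8 ∈? 0 ∷ 1 ∷ 3 ∷ 4 ∷ 5 ∷ 7 ∷ [])

IsD₄ : ℕ → ℕ → List ℕ → Set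
IsD₄ u v λs =
    u ≡ #parts 4 (0 ∷ 1 ∷ []) λs + 2 * #parts 8 (6 ∷ []) λs
  × v ≡ #parts 4 (0 ∷ 3 ∷ []) λs + 2 * #parts 8 (2 ∷ []) λs
  × All (_≢ 2) λs
  × Linked Gap λs

isD₄? : ∀ u v → Decidable (IsD₄ u v)
isD₄? u v λs =
        u ≟ #parts 4 (0 ∷ 1 ∷ []) λs + 2 * #parts 8 (6 ∷ []) λs
  ×-dec v ≟ #parts 4 (0 ∷ 3 ∷ []) λs + 2 * #parts 8 (2 ∷ []) λs
  ×-dec all? (λ x → ¬? (x ≟ 2)) λs
  ×-dec linked? gap? λs

D₄ : ℕ → ℕ → ℕ → ℕ
D₄ u v n = length (filter (isD₄? u v) (partitions n))

-- The rest shows that partitions n lists every partition of n exactly once,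
-- so the lengths above are the intended cardinalities.

private
  compositionsFrom-head : ∀ k n {xs} → xs ∈ compositionsFrom k n →
    ∃[ x ] ∃[ ys ] xs ≡ x ∷ ys × suc k ≤ x
  compositionsFrom-head k zero    (here refl) = _ , _ , refl , ≤-refl
  compositionsFrom-head k (suc n) p with ∈-++⁻ (map (suc k ∷_) (compositionsFrom 0 n)) p
  ... | inj₁ q with ∈-map⁻ (suc k ∷_) q
  ...   | _ , _ , refl = _ , _ , refl , ≤-refl
  compositionsFrom-head k (suc n) p | inj₂ q with compositionsFrom-head (suc k) n q
  ...   | _ , _ , eq , k≤x = _ , _ , eq , ≤-trans (n≤1+n _) k≤x

  compositionsFrom-sound : ∀ k n {xs} → xs ∈ compositionsFrom k n →
    All (0 <_) xs × sum xs ≡ suc k + n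
  compositionsFrom-sound k zero    (here refl) = z<s ∷ [] , refl
  compositionsFrom-sound k (suc n) p with ∈-++⁻ (map (suc k ∷_) (compositionsFrom 0 n)) p
  ... | inj₁ q with ∈-map⁻ (suc k ∷_) q
  ...   | _ , r , refl with compositionsFrom-sound 0 n r
  ...     | pos , eq = z<s ∷ pos , cong (suc k +_) eq
  compositionsFrom-sound k (suc n) p | inj₂ q with compositionsFrom-sound (suc k) n q
  ...   | pos , eq = pos , trans eq (cong suc (sym (+-suc k n)))

  compositionsFrom-complete : ∀ k n x xs → suc k ≤ x → All (0 <_) xs →
    x + sum xs ≡ suc k + n → x ∷ xs ∈ compositionsFrom k n
  compositionsFrom-complete k n x xs k<x pos eq with m≤n⇒m<n∨m≡n k<x
  compositionsFrom-complete k zero _ [] _ _ _ | inj₂ refl = here refl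
  compositionsFrom-complete k zero _ (y ∷ ys) _ (0<y ∷ _) eq | inj₂ refl =
    contradiction (m+n≡0⇒m≡0 y (+-cancelˡ-≡ (suc k) _ _ eq)) (m<n⇒n≢0 0<y)
  compositionsFrom-complete k (suc n) _ [] _ _ eq | inj₂ refl
    with () ← +-cancelˡ-≡ (suc k) 0 (suc n) eq
  compositionsFrom-complete k (suc n) _ (y ∷ ys) _ (0<y ∷ pos) eq | inj₂ refl =
    ∈-++⁺ˡ (∈-map⁺ (suc k ∷_)
      (compositionsFrom-complete 0 n y ys 0<y pos (+-cancelˡ-≡ (suc k) _ _ eq)))
  compositionsFrom-complete k zero x xs _ _ eq | inj₁ k+1<x
    with () ← <-irrefl (trans (sym (+-identityʳ (suc k))) (sym eq))
                (<-≤-trans k+1<x (m≤m+n x (sum xs)))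
  compositionsFrom-complete k (suc n) x xs _ pos eq | inj₁ k+1<x =
    ∈-++⁺ʳ (map (suc k ∷_) (compositionsFrom 0 n))
      (compositionsFrom-complete (suc k) n x xs k+1<x pos
        (trans eq (cong suc (+-suc k n))))

  compositionsFrom-unique : ∀ k n → Unique (compositionsFrom k n)
  compositionsFrom-unique k zero    = [] ∷ []
  compositionsFrom-unique k (suc n) =
    Uniqueₚ.++⁺ (Uniqueₚ.map⁺ ∷-injectiveʳ (compositionsFrom-unique 0 n))
                (compositionsFrom-unique (suc k) n)
                λ (p , q) → disjoint p q
    where
    disjoint : ∀ {xs} → xs ∈ map (suc k ∷_) (compositionsFrom 0 n) →
               xs ∈ compositionsFrom (suc k) n → ⊥
    disjoint p q with ∈-map⁻ (suc k ∷_) p | compositionsFrom-head (suc k) n q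
    ... | _ , _ , refl | _ , _ , refl , lt = <-irrefl refl lt

  compositions-sound : ∀ n {xs} → xs ∈ compositions n → All (0 <_) xs × sum xs ≡ n
  compositions-sound zero    (here refl) = [] , refl
  compositions-sound (suc n) p           = compositionsFrom-sound 0 n p

  compositions-complete : ∀ n xs → All (0 <_) xs → sum xs ≡ n → xs ∈ compositions n
  compositions-complete zero    []           _           _  = here refl
  compositions-complete (suc n) (x ∷ xs)     (0<x ∷ pos) eq =
    compositionsFrom-complete 0 n x xs 0<x pos eq
  compositions-complete zero    (suc _ ∷ _)  _           ()
  compositions-complete zero    (zero ∷ _)   (() ∷ _)    _

  compositions-unique : ∀ n → Unique (compositions n)
  compositions-unique zero    = [] ∷ []
  compositions-unique (suc n) = compositionsFrom-unique 0 n

∈-partitions : ∀ n λs → λs ∈ partitions n ⇔ IsPartition n λs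
∈-partitions n λs = mk⇔
  (λ p → let q , dec = ∈-filter⁻ (linked? _≥?_) {xs = compositions n} p
         in dec , compositions-sound n q)
  (λ (dec , pos , eq) →
    ∈-filter⁺ (linked? _≥?_) (compositions-complete n λs pos eq) dec)

partitions-unique : ∀ n → Unique (partitions n)
partitions-unique n = Uniqueₚ.filter⁺ (linked? _≥?_) (compositions-unique n)

module Submission where

open import Defs
open import Data.Bool using (Bool; true; false; if_then_else_)
open import Data.Empty using (⊥)
open import Data.List using (List; []; _∷_; map; _++_; filter; length)
open import Data.List.Membership.Propositional using (_∈_)
open import Data.List.Membership.Propositional.Properties
  using (∈-map⁺; ∈-map⁻; ∈-++⁺ˡ; ∈-++⁺ʳ; ∈-++⁻; ∈-filter⁺; ∈-filter⁻)
open import Data.List.Properties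
  using (∷-injectiveʳ; filter-++; filter-all; filter-none; map-++; map-∘; map-cong)
open import Data.List.Relation.Unary.All as All using (All; []; _∷_)
import Data.List.Relation.Unary.All.Properties as Allₚ
open import Data.List.Relation.Unary.AllPairs using ([]; _∷_)
open import Data.List.Relation.Unary.Any using (here; there)
open import Data.List.Relation.Unary.Linked as Linked using (Linked; []; [-]; _∷_)
open import Data.List.Relation.Unary.Unique.Propositional using (Unique)
open import Data.List.Membership.Propositional.Properties.WithK using (unique∧set⇒bag)
open import Data.List.Relation.Binary.BagAndSetEquality using (∼bag⇒↭)
open import Data.List.Relation.Binary.Permutation.Propositional.Properties using (↭-length)
open import Data.List.Relation.Unary.Linked.Properties using (Linked⇒AllPairs)
import Data.List.Relation.Unary.AllPairs as AllPairs
import Data.List.Relation.Unary.Unique.Propositional.Properties as Uniqueₚ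
open import Data.Nat
open import Data.Nat.DivMod
open import Data.Nat.ListAction using (sum)
open import Data.Nat.ListAction.Properties using (sum-++)
open import Data.Nat.Properties
open import Data.Nat.Tactic.RingSolver using (solve-∀)
open import Data.Product using (_×_; _,_; ∃₂)
open import Data.Sum using (inj₁; inj₂)
open import Data.Unit using (⊤; tt)
open import Function using (_∘_; mk⇔; Equivalence; id)
open import Relation.Binary using () renaming (Decidable to Decidable₂)
open import Relation.Binary.PropositionalEquality
open import Relation.Nullary using (¬_; does; yes; no; contradiction)
open import Relation.Nullary.Decidable using (dec-true; dec-false; from-no; ¬?; _×-dec_)
open import Relation.Unary using (Decidable)

open import Data.List.Membership.DecPropositional _≟_ using (_∈?_)

-- The part 1 mod 4 (a) and the part 3 mod 4 (b) are exchanged by adding 2, and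
-- a part of a D₄-partition with weight aⁱbʲ, i + j ∈ {1, 2}, passes to weight bⁱaʲ
-- by adding 2(i + j). If S k (a , b) is the generating function of the
-- D₄-partitions with parts at most k, then for k ≡ 4 mod 8
--   S k (a , b) = (1 + aq) S (k − 3) (bq² , aq²),
-- while partitions into distinct odd parts satisfy the same equation with k − 2
-- for k − 3 (remove the part 1, then subtract 2 from all the others). For k → ∞
-- the equation determines the generating function. For D₄-partitions it is proved
-- by induction in steps of 8, from the recurrences that the gap conditions give
-- for the partitions with a prescribed largest part.

-- Instead of a generating function Σ aᵘbᵛqⁿ we use all sums Σ φ u v n at once:
-- multiplication by a monomial becomes a shift of the argument φ, and no
-- ring of power series is needed.
Weight : Set
Weight = ℕ → ℕ → ℕ → ℕ

-- Weights and the operator `T`.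

infix 4 _≗₃_
_≗₃_ : Weight → Weight → Set
φ ≗₃ ψ = ∀ u v n → φ u v n ≡ ψ u v n

interchange : ∀ p q r s → p + q + (r + s) ≡ p + r + (q + s)
interchange = solve-∀

infixl 6 _⊕_
_⊕_ : Weight → Weight → Weight
(φ ⊕ ψ) u v n = φ u v n + ψ u v n

shift : ℕ → ℕ → ℕ → Weight → Weight
shift i j m φ u v n = φ (i + u) (j + v) (m + n)

-- Dual to the substitution a ↦ bq², b ↦ aq².
swap : Weight → Weight
swap φ u v n = φ v u (2 * (u + v) + n)

aq : Weight → Weight
aq = shift 1 0 1

-- Dual to f (a , b) ↦ (1 + aq) f (bq² , aq²).
T : Weight → Weight
T φ = swap φ ⊕ swap (aq φ)

T^ : ℕ → Weight → Weight
T^ zero    φ = φ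
T^ (suc r) φ = T^ r (T φ)

-- Each T adds at least 1 to the coefficient m, so after more than B steps φ vanishes
-- on all nonempty partitions.
Vanishes : ℕ → ℕ → Weight → Set
Vanishes B m φ = ∀ u v n → B < n + m * (u + v) → φ u v n ≡ 0

-- `swap` adds `2 * (u + v)` to the size, and one `u + v` already pays for raising `m` to `suc m`;
-- `aq` only makes the arguments larger.
T-vanishes : ∀ {B m φ} → Vanishes B m φ → Vanishes B (suc m) (T φ)
T-vanishes {B} {m} {φ} h u v n lt = cong₂ _+_
  (h v u (2 * (u + v) + n)
    (<-≤-trans lt (≤-trans (m≤m+n _ (u + v)) (≤-reflexive (eq₁ m u v n)))))
  (h (suc v) u (1 + (2 * (u + v) + n))
    (<-≤-trans lt (≤-trans (m≤m+n _ (u + v + 1 + m)) (≤-reflexive (eq₂ m u v n)))))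
  where
  eq₁ : ∀ m u v n → n + (1 + m) * (u + v) + (u + v) ≡ 2 * (u + v) + n + m * (v + u)
  eq₁ = solve-∀
  eq₂ : ∀ m u v n → n + (1 + m) * (u + v) + (u + v + 1 + m) ≡
                    1 + (2 * (u + v) + n) + m * (1 + v + u)
  eq₂ = solve-∀

-- The monomial aʲbⁱq^m becomes aⁱbʲq^(2(i + j) + m) under the substitution. The size has this form
-- so that it computes for numerals `i` and `j`: with `0 1 (9 + x)` it is `11 + x`.
swap-shift : ∀ i j m φ → swap (shift i j (2 * (i + j) + m) φ) ≗₃ shift j i m (swap φ)
swap-shift i j m φ u v n = cong (φ (i + v) (j + u)) (eq i j m u v n)
  where
  eq : ∀ i j m u v n → 2 * (i + j) + m + (2 * (u + v) + n) ≡ 2 * (j + u + (i + v)) + (m + n)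
  eq = solve-∀

aq-shift : ∀ i j m φ → aq (shift i j m φ) ≗₃ shift i j m (aq φ)
aq-shift i j m φ u v n = cong₂ (λ s t → φ s (j + v) t) (+-suc i u) (+-suc m n)

swap-aq-shift : ∀ i j m φ → swap (aq (shift i j (2 * (i + j) + m) φ)) ≗₃ shift j i m (swap (aq φ))
swap-aq-shift i j m φ u v n = trans
  (aq-shift i j (2 * (i + j) + m) φ v u (2 * (u + v) + n)) (swap-shift i j m (aq φ) u v n)

T-shift : ∀ i j m φ → T (shift i j (2 * (i + j) + m) φ) ≗₃ shift j i m (T φ)
T-shift i j m φ u v n = cong₂ _+_ (swap-shift i j m φ u v n) (swap-aq-shift i j m φ u v n)

-- As a weight this extracts the coefficient of aᵘbᵛqⁿ.
δ : ℕ → ℕ → ℕ → Weight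
δ u v n u′ v′ n′ = if does (u ≟ u′ ×-dec v ≟ v′ ×-dec n ≟ n′) then 1 else 0

δ-vanishes : ∀ u v n → Vanishes n 0 (δ u v n)
δ-vanishes u v n u′ v′ n′ n<n′+0 = cong (if_then 1 else 0)
  (dec-false (u ≟ u′ ×-dec v ≟ v′ ×-dec n ≟ n′)
    λ (_ , _ , n≡n′) → <⇒≢ (subst (n <_) (+-identityʳ n′) n<n′+0) n≡n′)

-- A rejected summand vanishes without leaving `+ 0`, so with closed booleans the sum in `E-expand`
-- computes to the admissible terms.
addIf : Bool → ℕ → ℕ → ℕ
addIf true  s e = s + e
addIf false s e = s

-- Partitions as chains of a relation, and their generating functions.

module Chains
  {P : ℕ → Set} (P? : Decidable P)
  {R : ℕ → ℕ → Set} (R? : Decidable₂ R) (R⇒> : ∀ {x y} → R x y → x > y)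
  (a b : ℕ → ℕ)
  where

  Below : ℕ → List ℕ → Set
  Below x []      = ⊤
  Below x (y ∷ _) = R x y

  below? : ∀ x → Decidable (Below x)
  below? x []      = yes tt
  below? x (y ∷ _) = R? x y

  headed : ℕ → List (List ℕ) → List (List ℕ)
  headed x L = if does (P? x) then map (x ∷_) (filter (below? x) L) else []

  chains : ℕ → List (List ℕ)
  chains zero    = [] ∷ []
  chains (suc k) = chains k ++ headed (suc k) (chains k)

  weigh : Weight → List ℕ → ℕ
  weigh φ xs = φ (sum (map a xs)) (sum (map b xs)) (sum xs)

  total : Weight → List (List ℕ) → ℕ
  total φ L = sum (map (weigh φ) L)

  -- In S and F the parts are at most k, in E the largest part is k, and in F a part x
  -- may be prepended.
  F : ℕ → ℕ → Weight → ℕ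
  F x k φ = total φ (filter (below? x) (chains k))

  total-++ : ∀ φ L L′ → total φ (L ++ L′) ≡ total φ L + total φ L′
  total-++ φ L L′ = trans (cong sum (map-++ (weigh φ) L L′)) (sum-++ (map (weigh φ) L) _)

  total-cong : ∀ {φ ψ} → φ ≗₃ ψ → ∀ L → total φ L ≡ total ψ L
  total-cong φ≗ψ L = cong sum (map-cong (λ _ → φ≗ψ _ _ _) L)

  total-⊕ : ∀ φ ψ L → total (φ ⊕ ψ) L ≡ total φ L + total ψ L
  total-⊕ φ ψ []       = refl
  total-⊕ φ ψ (xs ∷ L) = trans (cong (weigh φ xs + weigh ψ xs +_) (total-⊕ φ ψ L))
    (interchange (weigh φ xs) (weigh ψ xs) (total φ L) (total ψ L))

  total-0 : ∀ {φ} → (∀ u v n → φ u v n ≡ 0) → ∀ L → total φ L ≡ 0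
  total-0 φ≗0 []      = refl
  total-0 φ≗0 (_ ∷ L) = cong₂ _+_ (φ≗0 _ _ _) (total-0 φ≗0 L)

  -- Opacity keeps `S` and `E` at bounds such as `5 + j * 8` from unfolding into lists. They are
  -- used through the laws of this block and unfolded only for the base cases.
  opaque
    S : ℕ → Weight → ℕ
    S k φ = total φ (chains k)

    E : ℕ → Weight → ℕ
    E zero    φ = 0
    E (suc k) φ = total φ (headed (suc k) (chains k))

    S-total : ∀ k φ → total φ (chains k) ≡ S k φ
    S-total k φ = refl

    S-zero : ∀ φ → S 0 φ ≡ φ 0 0 0
    S-zero φ = +-identityʳ _

    S-cong : ∀ k {φ ψ} → φ ≗₃ ψ → S k φ ≡ S k ψ
    S-cong k φ≗ψ = total-cong φ≗ψ (chains k)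

    S-⊕ : ∀ k φ ψ → S k (φ ⊕ ψ) ≡ S k φ + S k ψ
    S-⊕ k φ ψ = total-⊕ φ ψ (chains k)

    S-suc : ∀ k φ → S (suc k) φ ≡ S k φ + E (suc k) φ
    S-suc k φ = total-++ φ (chains k) _

    E-cong : ∀ k {φ ψ} → φ ≗₃ ψ → E k φ ≡ E k ψ
    E-cong zero    φ≗ψ = refl
    E-cong (suc k) φ≗ψ = total-cong φ≗ψ (headed (suc k) (chains k))

    E-⊕ : ∀ k φ ψ → E k (φ ⊕ ψ) ≡ E k φ + E k ψ
    E-⊕ zero    φ ψ = refl
    E-⊕ (suc k) φ ψ = total-⊕ φ ψ (headed (suc k) (chains k))

    E-part : ∀ k φ → P (suc k) →
      E (suc k) φ ≡ F (suc k) k (shift (a (suc k)) (b (suc k)) (suc k) φ)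
    E-part k φ p rewrite dec-true (P? (suc k)) p =
      cong sum (sym (map-∘ (filter (below? (suc k)) (chains k))))

    E-nonpart : ∀ k φ → ¬ P (suc k) → E (suc k) φ ≡ 0
    E-nonpart k φ ¬p rewrite dec-false (P? (suc k)) ¬p = refl

    headed-All : ∀ {Q : List ℕ → Set} x L → (∀ xs → Q (x ∷ xs)) → All Q (headed x L)
    headed-All x L q with P? x
    ... | yes _ = Allₚ.map⁺ (All.universal q (filter (below? x) L))
    ... | no _  = []

    -- All members of `headed (suc k)` begin with `suc k`, so `x` may be prepended to all of them or
    -- to none.
    F-suc : ∀ x k φ → F x (suc k) φ ≡ addIf (does (R? x (suc k))) (F x k φ) (E (suc k) φ)
    F-suc x k φ = trans
      (cong (total φ) (filter-++ (below? x) (chains k) H))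
      (trans (total-++ φ (filter (below? x) (chains k)) (filter (below? x) H)) last)
      where
      H : List (List ℕ)
      H = headed (suc k) (chains k)
      last : F x k φ + total φ (filter (below? x) H) ≡
             addIf (does (R? x (suc k))) (F x k φ) (E (suc k) φ)
      last with R? x (suc k)
      ... | yes r = cong (λ L → F x k φ + total φ L)
                      (filter-all (below? x) (headed-All (suc k) (chains k) (λ _ → r)))
      ... | no ¬r = trans (cong (λ L → F x k φ + total φ L)
                      (filter-none (below? x) (headed-All (suc k) (chains k) (λ _ → ¬r))))
                      (+-identityʳ _)

    F-all : ∀ x k φ → (∀ y → 0 < y → y ≤ k → R x y) → F x k φ ≡ S k φ
    F-all x zero    φ r = refl
    F-all x (suc k) φ r = trans (F-suc x k φ)
      (trans (cong (λ c → addIf c (F x k φ) (E (suc k) φ))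
                   (dec-true (R? x (suc k)) (r (suc k) z<s ≤-refl)))
      (trans (cong (_+ E (suc k) φ) (F-all x k φ λ y 0<y y≤k → r y 0<y (m≤n⇒m≤1+n y≤k)))
             (sym (S-suc k φ))))

    E-zero : ∀ k φ → (∀ u v n → P (suc k) → φ (a (suc k) + u) (b (suc k) + v) (suc k + n) ≡ 0) →
      E (suc k) φ ≡ 0
    E-zero k φ h with P? (suc k)
    ... | no _  = refl
    ... | yes p = trans (cong sum (sym (map-∘ (filter (below? (suc k)) (chains k)))))
                    (total-0 (λ u v n → h u v n p) (filter (below? (suc k)) (chains k)))

  -- A part larger than `B` alone pushes the size beyond `B`, where `φ` is zero. This replaces the
  -- limit k → ∞.
  S-stable : ∀ {B φ} → Vanishes B 0 φ → ∀ {k} → B ≤ k → S k φ ≡ S B φ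
  S-stable {B} {φ} h B≤k = go (≤⇒≤′ B≤k)
    where
    go : ∀ {k} → B ≤′ k → S k φ ≡ S B φ
    go (≤′-reflexive refl) = refl
    go (≤′-step {k} B≤k) = trans (S-suc k φ) (trans
      (cong₂ _+_ (go B≤k)
        (E-zero k φ λ u v n _ → h _ _ _
          (≤-trans (s≤s (≤′⇒≤ B≤k)) (≤-trans (m≤m+n (suc k) n) (m≤m+n (suc k + n) 0)))))
      (+-identityʳ _))

  module _ (weight>0 : ∀ {x} → P x → 0 < a x + b x) where

    -- Each part has positive weight, so only the empty partition survives.
    S-empty : ∀ φ → (∀ u v n → 0 < u + v → φ u v n ≡ 0) → ∀ k → S k φ ≡ φ 0 0 0
    S-empty φ h zero    = S-zero φ
    S-empty φ h (suc k) = trans (S-suc k φ) (trans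
      (cong₂ _+_ (S-empty φ h k)
        (E-zero k φ λ u v n p → h _ _ _
          (≤-trans (weight>0 p) (+-mono-≤ (m≤m+n (a (suc k)) u) (m≤m+n (b (suc k)) v)))))
      (+-identityʳ _))

    module _ (S-T : ∀ k → ∃₂ λ k₁ k₂ → k ≤ k₁ × k ≤ k₂ × ∀ φ → S k₁ φ ≡ S k₂ (T φ)) where

      -- Uniqueness of the solution: the right side no longer mentions the family of partitions. By
      -- stability both bounds of `S-T` move back to `B`, and once the coefficient exceeds `B`, `φ`
      -- is zero on all nonempty partitions.
      S-T^ : ∀ {B} r m φ → Vanishes B m φ → B < r + m → S B φ ≡ T^ r φ 0 0 0
      S-T^ {B} zero m φ h B<m = S-empty φ (λ u v n 0<u+v → h u v n
        (<-≤-trans B<m (≤-trans (m≤m*n m (u + v) {{>-nonZero 0<u+v}}) (m≤n+m _ n)))) B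
      S-T^ {B} (suc r) m φ h B<r+m with S-T B
      ... | k₁ , k₂ , B≤k₁ , B≤k₂ , eq = begin
        S B φ           ≡⟨ S-stable (vanishes₀ {m} h) B≤k₁ ⟨
        S k₁ φ          ≡⟨ eq φ ⟩
        S k₂ (T φ)      ≡⟨ S-stable (vanishes₀ {suc m} (T-vanishes {m = m} h)) B≤k₂ ⟩
        S B (T φ)       ≡⟨ S-T^ r (suc m) (T φ) (T-vanishes {m = m} h)
                                (subst (B <_) (sym (+-suc r m)) B<r+m) ⟩
        T^ r (T φ) 0 0 0 ∎
        where
        open ≡-Reasoning
        vanishes₀ : ∀ {m φ} → Vanishes B m φ → Vanishes B 0 φ
        vanishes₀ h u v n lt = h u v n (≤-trans lt (+-monoʳ-≤ n z≤n))

  -- Membership and uniqueness in `chains`, and counting.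

  HeadAtMost : ℕ → List ℕ → Set
  HeadAtMost k []      = ⊤
  HeadAtMost k (x ∷ _) = x ≤ k

  ∈-headed⁻ : ∀ x L {xs} → xs ∈ headed x L →
    ∃₂ λ (_ : P x) ys → ys ∈ L × Below x ys × xs ≡ x ∷ ys
  ∈-headed⁻ x L xs∈ with P? x
  ... | yes p with ∈-map⁻ (x ∷_) xs∈
  ...   | ys , ys∈ , eq with ∈-filter⁻ (below? x) {xs = L} ys∈
  ...     | ys∈L , below = p , ys , ys∈L , below , eq

  ∈-headed⁺ : ∀ x L {xs} → P x → xs ∈ L → Below x xs → x ∷ xs ∈ headed x L
  ∈-headed⁺ x L p xs∈ below rewrite dec-true (P? x) p =
    ∈-map⁺ (x ∷_) (∈-filter⁺ (below? x) xs∈ below)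

  Linked-∷ : ∀ {x xs} → Below x xs → Linked R xs → Linked R (x ∷ xs)
  Linked-∷ {xs = []}    _ _ = [-]
  Linked-∷ {xs = _ ∷ _} r l = r ∷ l

  Linked⇒Below : ∀ {x xs} → Linked R (x ∷ xs) → Below x xs
  Linked⇒Below [-]     = tt
  Linked⇒Below (r ∷ _) = r

  chains-head : ∀ k {xs} → xs ∈ chains k → HeadAtMost k xs
  chains-head zero (here refl) = tt
  chains-head (suc k) {xs} xs∈ with ∈-++⁻ (chains k) xs∈
  ... | inj₂ xs∈′ with ∈-headed⁻ (suc k) (chains k) xs∈′
  ...   | _ , _ , _ , _ , refl = ≤-refl
  chains-head (suc k) {[]}    xs∈ | inj₁ _   = tt
  chains-head (suc k) {_ ∷ _} xs∈ | inj₁ xs∈′ = m≤n⇒m≤1+n (chains-head k xs∈′)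

  chains-sound : ∀ k {xs} → xs ∈ chains k → All P xs × All (0 <_) xs × Linked R xs
  chains-sound zero (here refl) = [] , [] , []
  chains-sound (suc k) xs∈ with ∈-++⁻ (chains k) xs∈
  ... | inj₁ xs∈′ = chains-sound k xs∈′
  ... | inj₂ xs∈′ with ∈-headed⁻ (suc k) (chains k) xs∈′
  ...   | p , ys , ys∈ , below , refl with chains-sound k ys∈
  ...     | ps , pos , l = p ∷ ps , z<s ∷ pos , Linked-∷ below l

  chains-complete : ∀ k {xs} → All P xs → All (0 <_) xs → Linked R xs → HeadAtMost k xs →
    xs ∈ chains k
  chains-complete zero    {[]} _ _ _ _ = here refl
  chains-complete (suc k) {[]} _ _ _ _ = ∈-++⁺ˡ (chains-complete k [] [] [] tt)
  chains-complete zero    {_ ∷ _} _ (0<x ∷ _) _ x≤0 = contradiction x≤0 (<⇒≱ 0<x)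
  chains-complete (suc k) {x ∷ xs} (p ∷ ps) (0<x ∷ pos) l x≤1+k with m≤n⇒m<n∨m≡n x≤1+k
  ... | inj₁ x<1+k = ∈-++⁺ˡ (chains-complete k (p ∷ ps) (0<x ∷ pos) l (s≤s⁻¹ x<1+k))
  -- `R` decreases strictly, so the tail after `suc k` lies in `chains k`.
  ... | inj₂ refl = ∈-++⁺ʳ (chains k) (∈-headed⁺ (suc k) (chains k) p
        (chains-complete k ps pos (Linked.tail l) (head≤k xs (Linked⇒Below l))) (Linked⇒Below l))
    where
    head≤k : ∀ xs → Below (suc k) xs → HeadAtMost k xs
    head≤k []      _ = tt
    head≤k (_ ∷ _) r = s≤s⁻¹ (R⇒> r)

  chains-unique : ∀ k → Unique (chains k)
  chains-unique zero    = [] ∷ []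
  chains-unique (suc k) = Uniqueₚ.++⁺ (chains-unique k) headed-unique disjoint
    where
    headed-unique : Unique (headed (suc k) (chains k))
    headed-unique with P? (suc k)
    ... | yes _ = Uniqueₚ.map⁺ ∷-injectiveʳ (Uniqueₚ.filter⁺ (below? (suc k)) (chains-unique k))
    ... | no _  = []
    disjoint : ∀ {xs} → xs ∈ chains k × xs ∈ headed (suc k) (chains k) → ⊥
    disjoint (xs∈ , xs∈′) with ∈-headed⁻ (suc k) (chains k) xs∈′
    ... | _ , _ , _ , _ , refl = 1+n≰n (chains-head k xs∈)

  stats? : ∀ u v n → Decidable (λ xs → u ≡ sum (map a xs) × v ≡ sum (map b xs) × n ≡ sum xs)
  stats? u v n xs = u ≟ sum (map a xs) ×-dec v ≟ sum (map b xs) ×-dec n ≟ sum xs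

  length-filter-stats : ∀ u v n L → length (filter (stats? u v n) L) ≡ total (δ u v n) L
  length-filter-stats u v n []       = refl
  length-filter-stats u v n (xs ∷ L) with does (stats? u v n xs)
  ... | true  = cong suc (length-filter-stats u v n L)
  ... | false = length-filter-stats u v n L

  -- The two enumerations may differ in order, but duplicate-free lists with the same members are
  -- permutations of each other. The bound `n` suffices since no part exceeds the sum.
  count : ∀ {Q : List ℕ → Set} (Q? : Decidable Q) u v n →
    (∀ {xs} → IsPartition n xs → Q xs →
      All P xs × Linked R xs × u ≡ sum (map a xs) × v ≡ sum (map b xs)) →
    (∀ {xs} → All P xs → Linked R xs → u ≡ sum (map a xs) → v ≡ sum (map b xs) →
      Linked _≥_ xs × Q xs) →
    length (filter Q? (partitions n)) ≡ S n (δ u v n)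
  count Q? u v n to from = trans
    (↭-length (∼bag⇒↭ (unique∧set⇒bag
      (Uniqueₚ.filter⁺ Q? (partitions-unique n))
      (Uniqueₚ.filter⁺ (stats? u v n) (chains-unique n))
      (mk⇔ ⇒ ⇐))))
    (trans (length-filter-stats u v n (chains n)) (S-total n (δ u v n)))
    where
    head≤n : ∀ xs → sum xs ≡ n → HeadAtMost n xs
    head≤n []       _    = tt
    head≤n (x ∷ xs) refl = m≤m+n x (sum xs)
    ⇒ : ∀ {xs} → xs ∈ filter Q? (partitions n) → xs ∈ filter (stats? u v n) (chains n)
    ⇒ {xs} xs∈ with ∈-filter⁻ Q? {xs = partitions n} xs∈
    ... | xs∈′ , q with Equivalence.to (∈-partitions n xs) xs∈′
    ...   | part@(_ , pos , sum≡n) with to part q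
    ...     | ps , linked , u≡ , v≡ = ∈-filter⁺ (stats? u v n)
                (chains-complete n ps pos linked (head≤n xs sum≡n)) (u≡ , v≡ , sym sum≡n)
    ⇐ : ∀ {xs} → xs ∈ filter (stats? u v n) (chains n) → xs ∈ filter Q? (partitions n)
    ⇐ {xs} xs∈ with ∈-filter⁻ (stats? u v n) {xs = chains n} xs∈
    ... | xs∈′ , u≡ , v≡ , n≡sum with chains-sound n xs∈′
    ...   | ps , pos , linked with from ps linked u≡ v≡
    ...     | linked≥ , q = ∈-filter⁺ Q?
                (Equivalence.from (∈-partitions n xs) (linked≥ , pos , sym n≡sum)) q

-- Weights and gap conditions modulo 8.

indicator : ℕ → List ℕ → ℕ
indicator r rs = if does (r ∈? rs) then 1 else 0

[m+k*8]%4≡m%4 : ∀ m k → (m + k * 8) % 4 ≡ m % 4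
[m+k*8]%4≡m%4 m k = trans
  (cong (λ t → (m + t) % 4) (sym (*-assoc k 2 4))) ([m+kn]%n≡m%n m (k * 2) 4)

-- Modulo 8, a part has the monomial a for 1, 5; b for 3, 7; ab for 0, 4; a² for 6; b² for 2.
aᴰ bᴰ : ℕ → ℕ
aᴰ x = indicator (x % 4) (0 ∷ 1 ∷ []) + 2 * indicator (x % 8) (6 ∷ [])
bᴰ x = indicator (x % 4) (0 ∷ 3 ∷ []) + 2 * indicator (x % 8) (2 ∷ [])

aᴰ-periodic : ∀ r j → aᴰ (r + j * 8) ≡ aᴰ r
aᴰ-periodic r j = cong₂ (λ s t → indicator s (0 ∷ 1 ∷ []) + 2 * indicator t (6 ∷ []))
  ([m+k*8]%4≡m%4 r j) ([m+kn]%n≡m%n r j 8)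

bᴰ-periodic : ∀ r j → bᴰ (r + j * 8) ≡ bᴰ r
bᴰ-periodic r j = cong₂ (λ s t → indicator s (0 ∷ 3 ∷ []) + 2 * indicator t (2 ∷ []))
  ([m+k*8]%4≡m%4 r j) ([m+kn]%n≡m%n r j 8)

gap-cong : ∀ x y x′ y′ → x ∸ y ≡ x′ ∸ y′ → x % 8 ≡ x′ % 8 → does (gap? x y) ≡ does (gap? x′ y′)
gap-cong x y x′ y′ p q rewrite p | q = refl

-- `Gap` sees only the difference and the larger part modulo 8. For numerals `d` and `r` the right
-- side computes although `j` is a variable.
gap-periodic : ∀ d r j → does (gap? (d + (r + j * 8)) (r + j * 8)) ≡ does (gap? (d + r) r)
gap-periodic d r j = gap-cong (d + (r + j * 8)) (r + j * 8) (d + r) r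
  (trans (m+n∸n≡m d (r + j * 8)) (sym (m+n∸n≡m d r)))
  (trans (cong (_% 8) (sym (+-assoc d r (j * 8)))) ([m+kn]%n≡m%n (d + r) j 8))

gap⇒> : ∀ {x y} → Gap x y → x > y
gap⇒> {x} {y} (5≤x∸y , _) = ≰⇒> λ x≤y → contradiction (subst (5 ≤_) (m≤n⇒m∸n≡0 x≤y) 5≤x∸y) λ ()

gap-far : ∀ {x y} → 9 + y ≤ x → Gap x y
gap-far {x} {y} 9+y≤x = ≤-trans (m≤m+n 5 4) 9≤x∸y
  , far (from-no (9 ≤? 5)) , far (from-no (9 ≤? 6))
  , far (from-no (9 ≤? 7)) , far (from-no (9 ≤? 8))
  where
  9≤x∸y : 9 ≤ x ∸ y
  9≤x∸y = subst (_≤ x ∸ y) (m+n∸n≡m 9 y) (∸-monoˡ-≤ y 9+y≤x)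
  far : ∀ {d} {A : Set} → ¬ (9 ≤ d) → x ∸ y ≡ d → A
  far 9≰d refl = contradiction 9≤x∸y 9≰d

-- Recurrences for D₄-partitions with prescribed largest part.

module D = Chains (λ x → ¬? (x ≟ 2)) gap? gap⇒> aᴰ bᴰ
open D using (S; E; S-suc; S-cong; S-⊕; E-cong; E-⊕)

-- Remove the largest part and split by the next one. A next part at most `y` differs by at least 9
-- and is always allowed; each of the eight values in between is decided by `r` alone.
E-expand : ∀ r j φ →
  let y = r + j * 8
      ψ = shift (aᴰ (9 + r)) (bᴰ (9 + r)) (9 + y) φ
      _◂_ : ℕ → (ℕ × ℕ) → ℕ
      s ◂ (i , e) = addIf (does (gap? (9 + r) (i + r))) s e
  in E (9 + y) φ ≡
     (((((((S y ψ ◂ (1 , E (1 + y) ψ)) ◂ (2 , E (2 + y) ψ)) ◂ (3 , E (3 + y) ψ))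
       ◂ (4 , E (4 + y) ψ)) ◂ (5 , E (5 + y) ψ)) ◂ (6 , E (6 + y) ψ)) ◂ (7 , E (7 + y) ψ)) ◂ (8 , E (8 + y) ψ)
E-expand r j φ = begin
  E (9 + y) φ ≡⟨ D.E-part (8 + y) φ (λ ()) ⟩
  D.F (9 + y) (8 + y) (shift (aᴰ (9 + y)) (bᴰ (9 + y)) (9 + y) φ)
    ≡⟨ cong₂ (λ i j → D.F (9 + y) (8 + y) (shift i j (9 + y) φ))
         (aᴰ-periodic (9 + r) j) (bᴰ-periodic (9 + r) j) ⟩
  D.F (9 + y) (8 + y) ψ
    ≡⟨ step (7 + y) (gap-periodic 1 (8 + r) j) (step (6 + y) (gap-periodic 2 (7 + r) j)
      (step (5 + y) (gap-periodic 3 (6 + r) j) (step (4 + y) (gap-periodic 4 (5 + r) j)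
      (step (3 + y) (gap-periodic 5 (4 + r) j) (step (2 + y) (gap-periodic 6 (3 + r) j)
      (step (1 + y) (gap-periodic 7 (2 + r) j) (step y (gap-periodic 8 (1 + r) j)
      (D.F-all (9 + y) y ψ λ z _ z≤y → gap-far (+-monoʳ-≤ 9 z≤y))))))))) ⟩
  _ ∎
  where
  open ≡-Reasoning
  y = r + j * 8
  ψ = shift (aᴰ (9 + r)) (bᴰ (9 + r)) (9 + y) φ
  step : ∀ k {c s} → does (gap? (9 + y) (suc k)) ≡ c → D.F (9 + y) k ψ ≡ s →
    D.F (9 + y) (suc k) ψ ≡ addIf c s (E (suc k) ψ)
  step k refl refl = D.F-suc (9 + y) k ψ

S-suc₂ : ∀ k φ → S (2 + k) φ ≡ S k φ + E (1 + k) φ + E (2 + k) φ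
S-suc₂ k φ = trans (S-suc (1 + k) φ) (cong (_+ E (2 + k) φ) (S-suc k φ))

S-suc₃ : ∀ k φ → S (3 + k) φ ≡ S k φ + E (1 + k) φ + E (2 + k) φ + E (3 + k) φ
S-suc₃ k φ = trans (S-suc (2 + k) φ) (cong (_+ E (3 + k) φ) (S-suc₂ k φ))

S-suc₄ : ∀ k φ → S (4 + k) φ ≡ S k φ + E (1 + k) φ + E (2 + k) φ + E (3 + k) φ + E (4 + k) φ
S-suc₄ k φ = trans (S-suc (3 + k) φ) (cong (_+ E (4 + k) φ) (S-suc₃ k φ))

-- The factor that the largest parts 4, 5 and 6 mod 8 have in common: E₁₂, E₁₃, E₁₄.
Y : ℕ → Weight → ℕ
Y j φ = S (5 + j * 8) φ + E (7 + j * 8) φ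

-- In `E₉` to `E₁₆` the admissible next parts form an initial segment, which closes up to one `S`,
-- except for `E₁₂` to `E₁₄`: there `6 + j * 8` is left out below `7 + j * 8`, which gives `Y`.
E₉ : ∀ j φ → E (9 + j * 8) φ ≡ S (4 + j * 8) (shift 1 0 (9 + j * 8) φ)
E₉ j φ = trans (E-expand 0 j φ) (sym (S-suc₄ (j * 8) _))

E₁₀ : ∀ j φ → E (10 + j * 8) φ ≡ S (1 + j * 8) (shift 0 2 (10 + j * 8) φ)
E₁₀ j φ = E-expand 1 j φ

E₁₁ : ∀ j φ → E (11 + j * 8) φ ≡ S (5 + j * 8) (shift 0 1 (11 + j * 8) φ)
E₁₁ j φ = trans (E-expand 2 j φ) (sym (S-suc₃ (2 + j * 8) _))

E₁₂ : ∀ j φ → E (12 + j * 8) φ ≡ Y j (shift 1 1 (12 + j * 8) φ)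
E₁₂ j φ = trans (E-expand 3 j φ)
  (cong (_+ E (7 + j * 8) (shift 1 1 (12 + j * 8) φ)) (sym (S-suc₂ (3 + j * 8) _)))

E₁₃ : ∀ j φ → E (13 + j * 8) φ ≡ Y j (shift 1 0 (13 + j * 8) φ)
E₁₃ j φ = trans (E-expand 4 j φ)
  (cong (_+ E (7 + j * 8) (shift 1 0 (13 + j * 8) φ)) (sym (S-suc (4 + j * 8) _)))

E₁₄ : ∀ j φ → E (14 + j * 8) φ ≡ Y j (shift 2 0 (14 + j * 8) φ)
E₁₄ j φ = E-expand 5 j φ

E₁₅ : ∀ j φ → E (15 + j * 8) φ ≡ S (9 + j * 8) (shift 0 1 (15 + j * 8) φ)
E₁₅ j φ = trans (E-expand 6 j φ) (sym (S-suc₃ (6 + j * 8) _))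

E₁₆ : ∀ j φ → E (16 + j * 8) φ ≡ S (9 + j * 8) (shift 1 1 (16 + j * 8) φ)
E₁₆ j φ = trans (E-expand 7 j φ) (sym (S-suc₂ (7 + j * 8) _))

-- The induction in steps of 8.

Y-cong : ∀ j {φ ψ} → φ ≗₃ ψ → Y j φ ≡ Y j ψ
Y-cong j φ≗ψ = cong₂ _+_ (S-cong (5 + j * 8) φ≗ψ) (E-cong (7 + j * 8) φ≗ψ)

-- The base case of both families: 1 + aq + bq³ + abq⁴ = (1 + aq)(1 + bq³). The last term is the
-- part 4 for D₄ and `3 + 1` for distinct odd parts.
S₄-base : ∀ p q r s →
  (p + (q + (r + (s + 0)))) ≡
  ((p + q) + ((r + s) + 0))
S₄-base = solve-∀

-- `S₄` is the goal; the other fields make the induction go through. `E₈` is the recurrence `E₁₆`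
-- one period lower, included because `E-expand` starts at 9.
record Level (j : ℕ) : Set where
  field
    S₄  : ∀ φ → S (4 + j * 8) φ ≡ S (1 + j * 8) (T φ)
    S₉  : ∀ φ → S (9 + j * 8) φ ≡ Y j (T φ)
    S₁₀ : ∀ φ → S (10 + j * 8) φ ≡ S (7 + j * 8) (T φ)
    E₄  : ∀ φ → E (4 + j * 8) (swap φ) ≡ E (5 + j * 8) (swap (aq φ))
    E₅  : ∀ φ → E (5 + j * 8) φ ≡ E (2 + j * 8) (swap φ) + E (3 + j * 8) (swap φ)
    E₇  : ∀ φ → E (7 + j * 8) φ ≡ E (4 + j * 8) (swap φ) + E (5 + j * 8) (swap φ)
    E₈  : ∀ φ → E (8 + j * 8) φ ≡ S (1 + j * 8) (shift 1 1 (8 + j * 8) φ)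

opaque
  unfolding D.S D.E

  -- Both sides compute to explicit sums of values of `φ`, equal up to rearrangement.
  level-zero : Level 0
  level-zero = record
    { S₄  = λ φ → S₄-base (φ 0 0 0) (φ 1 0 1) (φ 0 1 3) (φ 1 1 4)
    ; S₉  = λ φ → eq₉ (φ 0 0 0) (φ 1 0 1) (φ 0 1 3) (φ 1 1 4) (φ 1 0 5) (φ 2 0 6) (φ 0 1 7)
        (φ 1 1 8) (φ 2 1 9) (φ 1 0 9) (φ 2 0 10) (φ 1 1 12) (φ 2 1 13)
    ; S₁₀ = λ φ → eq₁₀ (φ 0 0 0) (φ 1 0 1) (φ 0 1 3) (φ 1 1 4) (φ 1 0 5) (φ 2 0 6) (φ 0 1 7)
        (φ 1 1 8) (φ 2 1 9) (φ 1 0 9) (φ 2 0 10) (φ 1 1 12) (φ 2 1 13)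
        (φ 0 2 10) (φ 1 2 11)
    ; E₄  = λ φ → refl
    ; E₅  = λ φ → refl
    ; E₇  = λ φ → eq₇ (φ 0 1 7) (φ 1 1 8)
    ; E₈  = λ φ → refl
    }
    where
    -- On the left are the partitions with parts at most 9, in the order of `chains`. `w` stands
    -- twice: `7 + 1` and `8` share weight and size.
    eq₉ : ∀ p q r s t u v w a b c d e →
      (p + (q + (r + (s + (t + (u + (v + (w + (w + (a + (b + (c + (d + (e + 0)))))))))))))) ≡
      ((p + q) + ((r + s) + ((t + u) + ((w + a) + ((v + w) + 0))))) + ((b + c) + ((d + e) + 0))
    eq₉ = solve-∀
    eq₁₀ : ∀ p q r s t u v w a b c d e f g →
      (p + (q + (r + (s + (t + (u + (v + (w + (w +
        (a + (b + (c + (d + (e + (f + (g + 0)))))))))))))))) ≡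
      ((p + q) + ((r + s) + ((t + u) + ((w + a) + ((v + w) +
        ((f + g) + ((b + c) + ((d + e) + 0))))))))
    eq₁₀ = solve-∀
    eq₇ : ∀ p q → p + (q + 0) ≡ q + 0 + (p + 0)
    eq₇ = solve-∀

module _ {j : ℕ} (l : Level j) where
  open Level l
  open ≡-Reasoning

  private
    x = j * 8

  -- Only `S₄` contributes a term with `aq`. The terms without it, from `S₄`, `E₅` and `E₇`, have
  -- largest parts up to `5 + x` and add up to one `S`.
  Y-swap : ∀ φ → Y j φ ≡ S (1 + x) (swap (aq φ)) + S (5 + x) (swap φ)
  Y-swap φ = begin
    S (5 + x) φ + E (7 + x) φ
      ≡⟨ cong (_+ E (7 + x) φ) (S-suc (4 + x) φ) ⟩
    S (4 + x) φ + E (5 + x) φ + E (7 + x) φ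
      ≡⟨ cong₂ _+_ (cong₂ _+_ (trans (S₄ φ) (S-⊕ (1 + x) _ _)) (E₅ φ)) (E₇ φ) ⟩
    S (1 + x) (swap φ) + S (1 + x) (swap (aq φ)) + (E (2 + x) (swap φ) + E (3 + x) (swap φ))
      + (E (4 + x) (swap φ) + E (5 + x) (swap φ))
      ≡⟨ rearrange (S (1 + x) (swap φ)) _ _ _ _ _ ⟩
    S (1 + x) (swap (aq φ)) + (S (1 + x) (swap φ) + E (2 + x) (swap φ) + E (3 + x) (swap φ)
      + E (4 + x) (swap φ) + E (5 + x) (swap φ))
      ≡⟨ cong (S (1 + x) (swap (aq φ)) +_) (S-suc₄ (1 + x) (swap φ)) ⟨
    S (1 + x) (swap (aq φ)) + S (5 + x) (swap φ) ∎
    where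
    rearrange : ∀ s t p q r w → s + t + (p + q) + (r + w) ≡ t + (s + p + q + r + w)
    rearrange = solve-∀

  -- The monomial of `12 + x` is aq times that of `11 + x`, so both sums are expressed by the one
  -- weight `ψ`.
  E₁₁+E₁₂ : ∀ φ → E (11 + x) φ + E (12 + x) φ ≡ E (8 + x) (T φ) + E (9 + x) (T φ)
  E₁₁+E₁₂ φ = begin
    E (11 + x) φ + E (12 + x) φ
      ≡⟨ cong₂ _+_ (E₁₁ j φ) (trans (E₁₂ j φ)
           (Y-cong j λ u v n → sym (aq-shift 0 1 (11 + x) φ u v n))) ⟩
    S (5 + x) ψ + Y j (aq ψ)
      -- `E₄` converts `E (5 + x) (swap (aq ψ))` into `E (4 + x) (swap ψ)`, the term still missing
      -- from `S (4 + x) (swap ψ)`.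
      ≡⟨ cong₂ _+_ (trans (S-suc (4 + x) ψ) (cong₂ _+_ (trans (S₄ ψ) (S-⊕ (1 + x) _ _)) (E₅ ψ)))
                   (trans (Y-swap (aq ψ)) (cong (S (1 + x) (swap (aq (aq ψ))) +_)
                     (trans (S-suc (4 + x) _) (cong (S (4 + x) (swap (aq ψ)) +_) (sym (E₄ ψ)))))) ⟩
    (S (1 + x) (swap ψ) + S (1 + x) (swap (aq ψ)) + (E (2 + x) (swap ψ) + E (3 + x) (swap ψ)))
      + (S (1 + x) (swap (aq (aq ψ))) + (S (4 + x) (swap (aq ψ)) + E (4 + x) (swap ψ)))
      ≡⟨ rearrange (S (1 + x) (swap ψ)) _ _ _ _ _ _ ⟩
    (S (1 + x) (swap (aq ψ)) + S (1 + x) (swap (aq (aq ψ))))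
      + (S (1 + x) (swap ψ) + E (2 + x) (swap ψ) + E (3 + x) (swap ψ) + E (4 + x) (swap ψ)
         + S (4 + x) (swap (aq ψ)))
      ≡⟨ cong₂ _+_ (S-⊕ (1 + x) _ _) (cong (_+ S (4 + x) (swap (aq ψ))) (S-suc₃ (1 + x) (swap ψ))) ⟨
    S (1 + x) (T (aq ψ)) + (S (4 + x) (swap ψ) + S (4 + x) (swap (aq ψ)))
      ≡⟨ cong (S (1 + x) (T (aq ψ)) +_) (S-⊕ (4 + x) _ _) ⟨
    S (1 + x) (T (aq ψ)) + S (4 + x) (T ψ)
      ≡⟨ cong₂ _+_ (S-cong (1 + x) T-aqψ) (S-cong (4 + x) (T-shift 0 1 (9 + x) φ)) ⟩
    S (1 + x) (shift 1 1 (8 + x) (T φ)) + S (4 + x) (shift 1 0 (9 + x) (T φ))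
      ≡⟨ cong₂ _+_ (E₈ (T φ)) (E₉ j (T φ)) ⟨
    E (8 + x) (T φ) + E (9 + x) (T φ) ∎
    where
    ψ : Weight
    ψ = shift 0 1 (11 + x) φ
    T-aqψ : T (aq ψ) ≗₃ shift 1 1 (8 + x) (T φ)
    T-aqψ u v n = trans (cong₂ _+_ (aq-shift 0 1 (11 + x) φ v u (2 * (u + v) + n))
                                   (aq-shift 0 1 (11 + x) φ (1 + v) u (1 + (2 * (u + v) + n))))
                        (T-shift 1 1 (8 + x) φ u v n)
    rearrange : ∀ s t p q r w z → s + t + (p + q) + (r + (w + z)) ≡ t + r + (s + p + q + z + w)
    rearrange = solve-∀

  -- Both sides have the factor `Y`, and both monomials become abq^(16 + x).
  E₁₂-swap : ∀ φ → E (12 + x) (swap φ) ≡ E (13 + x) (swap (aq φ))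
  E₁₂-swap φ = begin
    E (12 + x) (swap φ)                        ≡⟨ E₁₂ j (swap φ) ⟩
    Y j (shift 1 1 (12 + x) (swap φ))
      ≡⟨ Y-cong j (λ u v n → cong (φ (1 + v) (1 + u)) (eq x u v n)) ⟩
    Y j (shift 1 0 (13 + x) (swap (aq φ)))     ≡⟨ E₁₃ j (swap (aq φ)) ⟨
    E (13 + x) (swap (aq φ))                   ∎
    where
    eq : ∀ x u v n → 2 * (1 + u + (1 + v)) + (12 + x + n) ≡ 1 + (2 * (1 + u + v) + (13 + x + n))
    eq = solve-∀

  -- The two terms of `Y-swap` are the recurrences `E₁₀` and `E₁₁`: aq times aq^(13 + x) is the
  -- image of b²q^(10 + x), and aq^(13 + x) that of bq^(11 + x).
  E₁₃-swap : ∀ φ → E (13 + x) φ ≡ E (10 + x) (swap φ) + E (11 + x) (swap φ)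
  E₁₃-swap φ = begin
    E (13 + x) φ ≡⟨ E₁₃ j φ ⟩
    Y j ψ        ≡⟨ Y-swap ψ ⟩
    S (1 + x) (swap (aq ψ)) + S (5 + x) (swap ψ)
      ≡⟨ cong₂ _+_ (S-cong (1 + x) λ u v n → trans (aq-shift 1 0 (13 + x) φ v u (2 * (u + v) + n))
                                                    (swap-shift 2 0 (10 + x) φ u v n))
                   (S-cong (5 + x) (swap-shift 1 0 (11 + x) φ)) ⟩
    S (1 + x) (shift 0 2 (10 + x) (swap φ)) + S (5 + x) (shift 0 1 (11 + x) (swap φ))
      ≡⟨ cong₂ _+_ (E₁₀ j (swap φ)) (E₁₁ j (swap φ)) ⟨
    E (10 + x) (swap φ) + E (11 + x) (swap φ) ∎
    where
    ψ : Weight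
    ψ = shift 1 0 (13 + x) φ

  -- The part `14 + x` contributes aq times what `13 + x` does, so `E₁₃-swap` for `φ` and for `aq φ`
  -- adds up to `T φ`. `E₁₅+E₁₆` works alike.
  E₁₃+E₁₄ : ∀ φ → E (13 + x) φ + E (14 + x) φ ≡ E (10 + x) (T φ) + E (11 + x) (T φ)
  E₁₃+E₁₄ φ = begin
    E (13 + x) φ + E (14 + x) φ
      ≡⟨ cong (E (13 + x) φ +_) (trans (E₁₄ j φ) (sym (E₁₃ j (aq φ)))) ⟩
    E (13 + x) φ + E (13 + x) (aq φ)
      ≡⟨ cong₂ _+_ (E₁₃-swap φ) (E₁₃-swap (aq φ)) ⟩
    E (10 + x) (swap φ) + E (11 + x) (swap φ)
      + (E (10 + x) (swap (aq φ)) + E (11 + x) (swap (aq φ)))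
      ≡⟨ interchange (E (10 + x) (swap φ)) _ _ _ ⟩
    E (10 + x) (swap φ) + E (10 + x) (swap (aq φ))
      + (E (11 + x) (swap φ) + E (11 + x) (swap (aq φ)))
      ≡⟨ cong₂ _+_ (E-⊕ (10 + x) _ _) (E-⊕ (11 + x) _ _) ⟨
    E (10 + x) (T φ) + E (11 + x) (T φ) ∎

  -- `S₉` turns the factor `S (9 + x)` of `E₁₅` into the factor `Y` of `E₁₃`.
  E₁₅-T : ∀ φ → E (15 + x) φ ≡ E (13 + x) (T φ)
  E₁₅-T φ = begin
    E (15 + x) φ                      ≡⟨ E₁₅ j φ ⟩
    S (9 + x) (shift 0 1 (15 + x) φ)  ≡⟨ S₉ _ ⟩
    Y j (T (shift 0 1 (15 + x) φ))    ≡⟨ Y-cong j (T-shift 0 1 (13 + x) φ) ⟩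
    Y j (shift 1 0 (13 + x) (T φ))    ≡⟨ E₁₃ j (T φ) ⟨
    E (13 + x) (T φ)                  ∎

  E₁₅-swap : ∀ φ → E (15 + x) φ ≡ E (12 + x) (swap φ) + E (13 + x) (swap φ)
  E₁₅-swap φ = begin
    E (15 + x) φ                                      ≡⟨ E₁₅-T φ ⟩
    E (13 + x) (T φ)                                  ≡⟨ E-⊕ (13 + x) _ _ ⟩
    E (13 + x) (swap φ) + E (13 + x) (swap (aq φ))
      ≡⟨ cong (E (13 + x) (swap φ) +_) (E₁₂-swap φ) ⟨
    E (13 + x) (swap φ) + E (12 + x) (swap φ)         ≡⟨ +-comm (E (13 + x) (swap φ)) _ ⟩
    E (12 + x) (swap φ) + E (13 + x) (swap φ)         ∎

  E₁₅+E₁₆ : ∀ φ → E (15 + x) φ + E (16 + x) φ ≡ E (12 + x) (T φ) + E (13 + x) (T φ)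
  E₁₅+E₁₆ φ = begin
    E (15 + x) φ + E (16 + x) φ
      ≡⟨ cong (E (15 + x) φ +_) (trans (E₁₆ j φ) (sym (E₁₅ j (aq φ)))) ⟩
    E (15 + x) φ + E (15 + x) (aq φ)
      ≡⟨ cong₂ _+_ (E₁₅-swap φ) (E₁₅-swap (aq φ)) ⟩
    E (12 + x) (swap φ) + E (13 + x) (swap φ)
      + (E (12 + x) (swap (aq φ)) + E (13 + x) (swap (aq φ)))
      ≡⟨ interchange (E (12 + x) (swap φ)) _ _ _ ⟩
    E (12 + x) (swap φ) + E (12 + x) (swap (aq φ))
      + (E (13 + x) (swap φ) + E (13 + x) (swap (aq φ)))
      ≡⟨ cong₂ _+_ (E-⊕ (12 + x) _ _) (E-⊕ (13 + x) _ _) ⟨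
    E (12 + x) (T φ) + E (13 + x) (T φ) ∎

  S₁₂ : ∀ φ → S (12 + x) φ ≡ S (9 + x) (T φ)
  S₁₂ φ = begin
    S (12 + x) φ                                             ≡⟨ S-suc₂ (10 + x) φ ⟩
    S (10 + x) φ + E (11 + x) φ + E (12 + x) φ               ≡⟨ +-assoc (S (10 + x) φ) _ _ ⟩
    S (10 + x) φ + (E (11 + x) φ + E (12 + x) φ)             ≡⟨ cong₂ _+_ (S₁₀ φ) (E₁₁+E₁₂ φ) ⟩
    S (7 + x) (T φ) + (E (8 + x) (T φ) + E (9 + x) (T φ))    ≡⟨ +-assoc (S (7 + x) (T φ)) _ _ ⟨
    S (7 + x) (T φ) + E (8 + x) (T φ) + E (9 + x) (T φ)      ≡⟨ S-suc₂ (7 + x) (T φ) ⟨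
    S (9 + x) (T φ)                                          ∎

  E₁₇-T : ∀ φ → E (17 + x) φ ≡ E (15 + x) (T φ)
  E₁₇-T φ = begin
    E (17 + x) φ                         ≡⟨ E₉ (suc j) φ ⟩
    S (12 + x) (shift 1 0 (17 + x) φ)    ≡⟨ S₁₂ _ ⟩
    S (9 + x) (T (shift 1 0 (17 + x) φ)) ≡⟨ S-cong (9 + x) (T-shift 1 0 (15 + x) φ) ⟩
    S (9 + x) (shift 0 1 (15 + x) (T φ)) ≡⟨ E₁₅ j (T φ) ⟨
    E (15 + x) (T φ)                     ∎

  E₁₈-T : ∀ φ → E (18 + x) φ ≡ E (14 + x) (T φ)
  E₁₈-T φ = begin
    E (18 + x) φ                         ≡⟨ E₁₀ (suc j) φ ⟩
    S (9 + x) (shift 0 2 (18 + x) φ)     ≡⟨ S₉ _ ⟩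
    Y j (T (shift 0 2 (18 + x) φ))       ≡⟨ Y-cong j (T-shift 0 2 (14 + x) φ) ⟩
    Y j (shift 2 0 (14 + x) (T φ))       ≡⟨ E₁₄ j (T φ) ⟨
    E (14 + x) (T φ)                     ∎

  -- Largest parts 13, 14 match 10, 11; then 15, 16 match 12, 13, and 17 matches 15 (all plus `x`).
  -- No partner for 14 has appeared yet, hence `Y`; in `S₁₈` the part `18 + x` supplies it.
  S₁₇ : ∀ φ → S (17 + x) φ ≡ Y (suc j) (T φ)
  S₁₇ φ = begin
    S (17 + x) φ
      ≡⟨ trans (S-suc (16 + x) φ) (cong (_+ E (17 + x) φ) (S-suc₄ (12 + x) φ)) ⟩
    S (12 + x) φ + E (13 + x) φ + E (14 + x) φ + E (15 + x) φ + E (16 + x) φ + E (17 + x) φ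
      ≡⟨ pair (S (12 + x) φ) _ _ _ _ _ ⟩
    S (12 + x) φ + (E (13 + x) φ + E (14 + x) φ) + (E (15 + x) φ + E (16 + x) φ) + E (17 + x) φ
      ≡⟨ cong₂ _+_ (cong₂ _+_ (cong₂ _+_ (S₁₂ φ) (E₁₃+E₁₄ φ)) (E₁₅+E₁₆ φ)) (E₁₇-T φ) ⟩
    S (9 + x) (T φ) + (E (10 + x) (T φ) + E (11 + x) (T φ))
      + (E (12 + x) (T φ) + E (13 + x) (T φ)) + E (15 + x) (T φ)
      ≡⟨ pair (S (9 + x) (T φ)) _ _ _ _ _ ⟨
    S (9 + x) (T φ) + E (10 + x) (T φ) + E (11 + x) (T φ) + E (12 + x) (T φ) + E (13 + x) (T φ)
      + E (15 + x) (T φ)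
      ≡⟨ cong (_+ E (15 + x) (T φ)) (S-suc₄ (9 + x) (T φ)) ⟨
    S (13 + x) (T φ) + E (15 + x) (T φ) ∎
    where
    pair : ∀ s p q r t w → s + p + q + r + t + w ≡ s + (p + q) + (r + t) + w
    pair = solve-∀

  S₁₈ : ∀ φ → S (18 + x) φ ≡ S (15 + x) (T φ)
  S₁₈ φ = begin
    S (18 + x) φ                                             ≡⟨ S-suc (17 + x) φ ⟩
    S (17 + x) φ + E (18 + x) φ                              ≡⟨ cong₂ _+_ (S₁₇ φ) (E₁₈-T φ) ⟩
    S (13 + x) (T φ) + E (15 + x) (T φ) + E (14 + x) (T φ)   ≡⟨ +-assoc (S (13 + x) (T φ)) _ _ ⟩
    S (13 + x) (T φ) + (E (15 + x) (T φ) + E (14 + x) (T φ))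
      ≡⟨ cong (S (13 + x) (T φ) +_) (+-comm (E (15 + x) (T φ)) _) ⟩
    S (13 + x) (T φ) + (E (14 + x) (T φ) + E (15 + x) (T φ)) ≡⟨ +-assoc (S (13 + x) (T φ)) _ _ ⟨
    S (13 + x) (T φ) + E (14 + x) (T φ) + E (15 + x) (T φ)   ≡⟨ S-suc₂ (13 + x) (T φ) ⟨
    S (15 + x) (T φ)                                         ∎

  level-suc : Level (suc j)
  level-suc = record
    { S₄ = S₁₂ ; S₉ = S₁₇ ; S₁₀ = S₁₈
    ; E₄ = E₁₂-swap ; E₅ = E₁₃-swap ; E₇ = E₁₅-swap ; E₈ = E₁₆ j }

level : ∀ j → Level j
level zero    = level-zero
level (suc j) = level-suc (level j)

-- Partitions into distinct odd parts.

aᶜ bᶜ : ℕ → ℕ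
aᶜ x = indicator (x % 4) (1 ∷ [])
bᶜ x = indicator (x % 4) (3 ∷ [])

module C = Chains (λ x → x % 4 ∈? 1 ∷ 3 ∷ []) _>?_ id aᶜ bᶜ

C-part : ∀ r j φ → suc r % 4 ∈ 1 ∷ 3 ∷ [] →
  C.S (suc r + j * 4) φ ≡
  C.S (r + j * 4) φ + C.S (r + j * 4) (shift (aᶜ (suc r)) (bᶜ (suc r)) (suc r + j * 4) φ)
C-part r j φ p = trans (C.S-suc k φ) (cong (C.S k φ +_) (begin
  C.E (suc k) φ
    ≡⟨ C.E-part k φ (subst (_∈ 1 ∷ 3 ∷ []) (sym k%4) p) ⟩
  C.F (suc k) k (shift (aᶜ (suc k)) (bᶜ (suc k)) (suc k) φ)
    ≡⟨ C.F-all (suc k) k _ (λ _ _ y≤k → s≤s y≤k) ⟩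
  C.S k (shift (aᶜ (suc k)) (bᶜ (suc k)) (suc k) φ)
    ≡⟨ cong (λ s → C.S k (shift (indicator s (1 ∷ [])) (indicator s (3 ∷ [])) (suc k) φ)) k%4 ⟩
  C.S k (shift (aᶜ (suc r)) (bᶜ (suc r)) (suc k) φ) ∎))
  where
  open ≡-Reasoning
  k = r + j * 4
  k%4 : suc k % 4 ≡ suc r % 4
  k%4 = [m+kn]%n≡m%n (suc r) j 4

C-nonpart : ∀ r j φ → ¬ (suc r % 4 ∈ 1 ∷ 3 ∷ []) → C.S (suc r + j * 4) φ ≡ C.S (r + j * 4) φ
C-nonpart r j φ ¬p = trans (C.S-suc (r + j * 4) φ) (trans
  (cong (C.S (r + j * 4) φ +_) (C.E-nonpart (r + j * 4) φ
    (¬p ∘ subst (_∈ 1 ∷ 3 ∷ []) ([m+kn]%n≡m%n (suc r) j 4))))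
  (+-identityʳ _))

C₃ : ∀ j φ → C.S (3 + j * 4) φ ≡ C.S (1 + j * 4) φ + C.S (1 + j * 4) (shift 0 1 (3 + j * 4) φ)
C₃ j φ = trans (C-part 2 j φ (there (here refl))) (cong₂ _+_ (skip φ) (skip _))
  where
  skip : ∀ φ → C.S (2 + j * 4) φ ≡ C.S (1 + j * 4) φ
  skip φ = C-nonpart 1 j φ (from-no (2 ∈? 1 ∷ 3 ∷ []))

C₅ : ∀ j φ → C.S (5 + j * 4) φ ≡ C.S (3 + j * 4) φ + C.S (3 + j * 4) (shift 1 0 (5 + j * 4) φ)
C₅ j φ = trans (C-part 4 j φ (here refl)) (cong₂ _+_ (skip φ) (skip _))
  where
  skip : ∀ φ → C.S (4 + j * 4) φ ≡ C.S (3 + j * 4) φ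
  skip φ = C-nonpart 3 j φ (from-no (0 ∈? 1 ∷ 3 ∷ []))

opaque
  unfolding C.S

  C₃-T-zero : ∀ φ → C.S 3 φ ≡ C.S 1 (T φ)
  C₃-T-zero φ = S₄-base (φ 0 0 0) (φ 1 0 1) (φ 0 1 3) (φ 1 1 4)

module _ where
  open ≡-Reasoning

  -- The generating function is a product over the odd parts. Raising the bound adds one factor on
  -- each side, and `T-shift` matches the two; since the residues 1 and 3 alternate, the induction
  -- is mutual.
  C₃-T : ∀ j φ → C.S (3 + j * 4) φ ≡ C.S (1 + j * 4) (T φ)
  C₅-T : ∀ j φ → C.S (5 + j * 4) φ ≡ C.S (3 + j * 4) (T φ)

  C₃-T zero    φ = C₃-T-zero φ
  C₃-T (suc j) φ = begin
    C.S (7 + j * 4) φ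
      ≡⟨ C₃ (suc j) φ ⟩
    C.S (5 + j * 4) φ + C.S (5 + j * 4) (shift 0 1 (7 + j * 4) φ)
      ≡⟨ cong₂ _+_ (C₅-T j φ) (trans (C₅-T j _)
           (C.S-cong (3 + j * 4) (T-shift 0 1 (5 + j * 4) φ))) ⟩
    C.S (3 + j * 4) (T φ) + C.S (3 + j * 4) (shift 1 0 (5 + j * 4) (T φ))
      ≡⟨ C₅ j (T φ) ⟨
    C.S (5 + j * 4) (T φ) ∎

  C₅-T j φ = begin
    C.S (5 + j * 4) φ
      ≡⟨ C₅ j φ ⟩
    C.S (3 + j * 4) φ + C.S (3 + j * 4) (shift 1 0 (5 + j * 4) φ)
      ≡⟨ cong₂ _+_ (C₃-T j φ) (trans (C₃-T j _)
           (C.S-cong (1 + j * 4) (T-shift 1 0 (3 + j * 4) φ))) ⟩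
    C.S (1 + j * 4) (T φ) + C.S (1 + j * 4) (shift 0 1 (3 + j * 4) (T φ))
      ≡⟨ C₃ j (T φ) ⟨
    C.S (3 + j * 4) (T φ) ∎

-- Comparison of the two families.

weightᶜ>0 : ∀ x → x % 4 ∈ 1 ∷ 3 ∷ [] → 0 < aᶜ x + bᶜ x
weightᶜ>0 x = go (x % 4)
  where
  go : ∀ r → r ∈ 1 ∷ 3 ∷ [] → 0 < indicator r (1 ∷ []) + indicator r (3 ∷ [])
  go _ (here refl)         = z<s
  go _ (there (here refl)) = z<s

weightᴰ>0 : ∀ x → 0 < aᴰ x + bᴰ x
weightᴰ>0 x = subst (λ y → 0 < aᴰ y + bᴰ y) (sym (m≡m%n+[m/n]*n x 8))
  (subst (0 <_) (sym (cong₂ _+_ (aᴰ-periodic (x % 8) (x / 8)) (bᴰ-periodic (x % 8) (x / 8))))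
    (go (x % 8) (m%n<n x 8)))
  where
  go : ∀ r → r < 8 → 0 < aᴰ r + bᴰ r
  go 0 _ = z<s
  go 1 _ = z<s
  go 2 _ = z<s
  go 3 _ = z<s
  go 4 _ = z<s
  go 5 _ = z<s
  go 6 _ = z<s
  go 7 _ = z<s
  go (suc (suc (suc (suc (suc (suc (suc (suc r)))))))) r<8 = contradiction r<8 (≤⇒≯ (m≤m+n 8 r))

k≤i+k*m : ∀ i k m .{{_ : NonZero m}} → k ≤ i + k * m
k≤i+k*m i k m = ≤-trans (m≤m*n k m) (m≤n+m (k * m) i)

-- `suc n` applications of `T` raise the coefficient from 0 to `suc n`, just beyond the bound `n`.
C-S≡T^ : ∀ u v n → C.S n (δ u v n) ≡ T^ (suc n) (δ u v n) 0 0 0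
C-S≡T^ u v n = C.S-T^ (λ {x} → weightᶜ>0 x)
  (λ k → 3 + k * 4 , 1 + k * 4 , k≤i+k*m 3 k 4 , k≤i+k*m 1 k 4 , C₃-T k)
  (suc n) 0 (δ u v n) (δ-vanishes u v n) (s≤s (m≤m+n n 0))

D-S≡T^ : ∀ u v n → S n (δ u v n) ≡ T^ (suc n) (δ u v n) 0 0 0
D-S≡T^ u v n = D.S-T^ (λ {x} _ → weightᴰ>0 x)
  (λ k → 4 + k * 8 , 1 + k * 8 , k≤i+k*m 4 k 8 , k≤i+k*m 1 k 8 , Level.S₄ (level k))
  (suc n) 0 (δ u v n) (δ-vanishes u v n) (s≤s (m≤m+n n 0))

#parts-sum : ∀ k .{{_ : NonZero k}} rs xs →
  #parts k rs xs ≡ sum (map (λ x → indicator (x % k) rs) xs)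
#parts-sum k rs []       = refl
#parts-sum k rs (x ∷ xs) with does (x % k ∈? rs)
... | true  = cong suc (#parts-sum k rs xs)
... | false = #parts-sum k rs xs

sum-+2* : ∀ (f g : ℕ → ℕ) xs →
  sum (map f xs) + 2 * sum (map g xs) ≡ sum (map (λ x → f x + 2 * g x) xs)
sum-+2* f g []       = refl
sum-+2* f g (x ∷ xs) = trans (eq (f x) (g x) (sum (map f xs)) (sum (map g xs)))
  (cong (f x + 2 * g x +_) (sum-+2* f g xs))
  where
  eq : ∀ p q s t → p + s + 2 * (q + t) ≡ p + 2 * q + (s + 2 * t)
  eq = solve-∀

#parts-+2* : ∀ rs ss xs → #parts 4 rs xs + 2 * #parts 8 ss xs ≡
  sum (map (λ x → indicator (x % 4) rs + 2 * indicator (x % 8) ss) xs)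
#parts-+2* rs ss xs = trans
  (cong₂ (λ s t → s + 2 * t) (#parts-sum 4 rs xs) (#parts-sum 8 ss xs)) (sum-+2* _ _ xs)

C₄≡S : ∀ u v n → C₄ u v n ≡ C.S n (δ u v n)
C₄≡S u v n = C.count (isC₄? u v) u v n
  (λ {xs} (linked , _) (unique , ps , u≡ , v≡) →
    ps , strict linked unique , trans u≡ (#parts-sum 4 _ xs) , trans v≡ (#parts-sum 4 _ xs))
  (λ {xs} ps linked u≡ v≡ →
    Linked.map <⇒≤ linked ,
    AllPairs.map (λ x>y → <⇒≢ x>y ∘ sym) (Linked⇒AllPairs (λ x>y y>z → <-trans y>z x>y) linked) ,
    ps , trans u≡ (sym (#parts-sum 4 _ xs)) , trans v≡ (sym (#parts-sum 4 _ xs)))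
  where
  strict : ∀ {xs} → Linked _≥_ xs → Unique xs → Linked _>_ xs
  strict []          _                      = []
  strict [-]         _                      = [-]
  strict (x≥y ∷ l) ((x≢y ∷ _) ∷ unique) = ≤∧≢⇒< x≥y (x≢y ∘ sym) ∷ strict l unique

D₄≡S : ∀ u v n → D₄ u v n ≡ S n (δ u v n)
D₄≡S u v n = D.count (isD₄? u v) u v n
  (λ {xs} _ (u≡ , v≡ , ps , linked) →
    ps , linked , trans u≡ (#parts-+2* _ _ xs) , trans v≡ (#parts-+2* _ _ xs))
  (λ {xs} ps linked u≡ v≡ →
    Linked.map (<⇒≤ ∘ gap⇒>) linked ,
    trans u≡ (sym (#parts-+2* _ _ xs)) , trans v≡ (sym (#parts-+2* _ _ xs)) , ps , linked)

theorem1p8 : (u v n : ℕ) → C₄ u v n ≡ D₄ u v n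
theorem1p8 u v n = begin
  C₄ u v n                     ≡⟨ C₄≡S u v n ⟩
  C.S n (δ u v n)              ≡⟨ C-S≡T^ u v n ⟩
  T^ (suc n) (δ u v n) 0 0 0   ≡⟨ D-S≡T^ u v n ⟨
  S n (δ u v n)                ≡⟨ D₄≡S u v n ⟨
  D₄ u v n                     ∎
  where open ≡-Reasoning
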